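{- For all barriers $B$, $\mathsf{RRT}^B_2\leq_{\mathrm{sW}}\mathsf{FS}^B$.
   Context: $\mathbb{N}$ is the set of natural numbers (including $0$). Subsets of $\mathbb{N}$ are identified with their strictly increasing enumerations; $s\sqsubset Y$ means that $s$ is a proper initial segment of $Y$ as a sequence; $\subset$ is strict set inclusion. A set $B$ of finite subsets of $\mathbb{N}$ is a barrier on an infinite set $X\subseteq\mathbb{N}$ if: (1) $\bigcup B=X$; (2) for all $s,t\in B$, $s\not\subset t$; (3) for every infinite $Y\subseteq X$ there is $s\in B$ with $s\sqsubset Y$. The set $X=\bigcup B$ is the base of $B$. For infinite $Y\subseteq X$, $B\vert Y=\{s\in B: s\subseteq Y\}$ (this is a barrier on $Y$, and every barrier $B'\subseteq B$ has this form). A function $f:B\to\mathbb{N}$ is $2$-bounded if $|f^{ -1}(x)|\le 2$ for every $x\in\mathbb{N}$. $\mathsf{RRT}^B_2$ is the problem whose instances are the $2$-bounded functions $f:B\to\mathbb{N}$, where a solution to $f$ is an infinite $Y$ contained in the base of $B$ such that $f$ is injective on $B\vert Y$. $\mathsf{FS}^B$ is the problem whose instances are the functions $f:B\to\mathbb{N}$, where a solution to $f$ is an infinite $Y$ contained in the base of $B$ such that for all $s\in B\vert Y$, if $f(s)\in Y$ then $f(s)\in s$. Instances and solutions are coded as subsets of $\mathbb{N}$ in a standard way, a coloring being given together with its domain (so that the barrier is uniformly computable from a coloring of it). For such problems $\mathsf{P},\mathsf{Q}$, $\mathsf{Q}\leq_{\mathrm{sW}}\mathsf{P}$ (strong Weihrauch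 reducibility) means: there are Turing functionals $\Phi,\Psi$ such that for every instance $I$ of $\mathsf{Q}$, $\Phi(I)$ is an instance of $\mathsf{P}$, and for every solution $\hat Y$ to $\Phi(I)$, $\Psi(\hat Y)$ is a solution to $I$ for $\mathsf{Q}$. -}

module Defs where

open import Data.Bool.Base using (Bool; T; if_then_else_)
open import Data.Fin.Base using (Fin)
open import Data.List.Base using (List; length; map; applyUpTo)
open import Data.List.Membership.Propositional using () renaming (_∈_ to _∈ˡ_)
open import Data.List.Relation.Unary.All using (All)
open import Data.List.Relation.Unary.Linked using (Linked)
open import Data.List.Relation.Unary.Unique.Propositional using (Unique)
open import Data.Nat.Base using (ℕ; zero; suc; _+_; _*_; _^_; _≤_; _<_)
open import Data.Nat.ListAction using (sum)
open import Data.Product.Base using (Σ; Σ-syntax; ∃; ∃-syntax; _×_; _,_)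
open import Data.Sum.Base using (_⊎_)
open import Data.Vec.Base using (Vec; []; _∷_; lookup)
open import Data.Vec.Relation.Binary.Pointwise.Inductive using (Pointwise)
open import Function.Bundles using (_⇔_)
open import Level using (0ℓ)
open import Relation.Binary.Core using (_Preserves_⟶_)
open import Relation.Binary.PropositionalEquality.Core using (_≡_)
open import Relation.Nullary.Negation.Core using (¬_)
open import Relation.Unary using (Pred; _∈_; _⊆_; _⊂_; _≐_; ⋃)

-- Subsets of ℕ that are instances, solutions or oracles are given by their
-- characteristic functions.

Subset : Set
Subset = ℕ → Bool

⟪_⟫ : Subset → Pred ℕ 0ℓ
⟪ Y ⟫ n = T (Y n)

Infinite : Pred ℕ 0ℓ → Set
Infinite P = ∀ n → ∃[ m ] n ≤ m × m ∈ P

-- The proof field is irrelevant, so that _≡_ on FinSet is equality of sets.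

record FinSet : Set where
  constructor finSet
  field
    elements    : List ℕ
    .increasing : Linked _<_ elements

open FinSet public

⟦_⟧ : FinSet → Pred ℕ 0ℓ
⟦ s ⟧ n = n ∈ˡ elements s

_Enumerates_ : (ℕ → ℕ) → Subset → Set
e Enumerates Y = e Preserves _<_ ⟶ _<_ × (∀ n → n ∈ ⟪ Y ⟫ ⇔ (∃[ i ] e i ≡ n))

-- Used only for infinite Y, where e exists and is unique, and where every
-- finite initial segment is proper.

_⊏_ : FinSet → Subset → Set
s ⊏ Y = ∃[ e ] e Enumerates Y × elements s ≡ applyUpTo e (length (elements s))

base : Pred FinSet 0ℓ → Pred ℕ 0ℓ
base B = ⋃ (∃ B) (λ (s , _) → ⟦ s ⟧)

record _IsBarrierOn_ (B : Pred FinSet 0ℓ) (X : Pred ℕ 0ℓ) : Set where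
  field
    infinite  : Infinite X
    union     : base B ≐ X
    antichain : ∀ s t → s ∈ B → t ∈ B → ¬ (⟦ s ⟧ ⊂ ⟦ t ⟧)
    meets     : ∀ Y → Infinite ⟪ Y ⟫ → ⟪ Y ⟫ ⊆ X → ∃[ s ] s ∈ B × s ⊏ Y

_∣_ : Pred FinSet 0ℓ → Subset → Pred FinSet 0ℓ
(B ∣ Y) s = s ∈ B × ⟦ s ⟧ ⊆ ⟪ Y ⟫

-- Membership in B is an irrelevant argument: the colour depends on s alone.

Coloring : Pred FinSet 0ℓ → Set
Coloring B = (s : FinSet) → .(s ∈ B) → ℕ

HasAtMost : ℕ → Pred FinSet 0ℓ → Set
HasAtMost k P = ∀ ss → Unique ss → All P ss → length ss ≤ k

preimage : ∀ {B} → Coloring B → ℕ → Pred FinSet 0ℓ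
preimage {B} f x s = Σ[ s∈B ∈ s ∈ B ] f s s∈B ≡ x

Bounded : ∀ {B} → ℕ → Coloring B → Set
Bounded k f = ∀ x → HasAtMost k (preimage f x)

-- The canonical index of s, namely the sum of 2 ^ x over x in s.

code : FinSet → ℕ
code s = sum (map (2 ^_) (elements s))

pair : ℕ → ℕ → ℕ
pair m n = (m + n) * (m + n) + m

-- C = { 2 · code s | s ∈ B } ∪ { 1 + 2 · pair (code s) (f s) | s ∈ B }:
-- the domain of f on the even numbers, the graph of f on the odd ones.
-- Both code and pair are injective, so C determines B and f.

_Codes_ : ∀ {B} → Subset → Coloring B → Set
_Codes_ {B} C f = ∀ k → k ∈ ⟪ C ⟫ ⇔
  ((∃[ s ] s ∈ B × k ≡ 2 * code s) ⊎
   (∃[ s ] Σ[ s∈B ∈ s ∈ B ] k ≡ 1 + 2 * pair (code s) (f s s∈B)))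

record Problem : Set₁ where
  field
    Instance     : Set
    IsCodeOf     : Subset → Instance → Set
    IsSolutionTo : Subset → Instance → Set

RRT₂ : Pred FinSet 0ℓ → Problem
RRT₂ B = record
  { Instance     = Σ[ f ∈ Coloring B ] Bounded 2 f
  ; IsCodeOf     = λ C (f , _) → C Codes f
  ; IsSolutionTo = λ Y (f , _) →
      Infinite ⟪ Y ⟫ × ⟪ Y ⟫ ⊆ base B ×
      (∀ s t → ((s∈B , _) : s ∈ (B ∣ Y)) ((t∈B , _) : t ∈ (B ∣ Y)) →
        f s s∈B ≡ f t t∈B → s ≡ t)
  }

FS : Pred FinSet 0ℓ → Problem
FS B = record
  { Instance     = Coloring B
  ; IsCodeOf     = _Codes_
  ; IsSolutionTo = λ Y f →
      Infinite ⟪ Y ⟫ × ⟪ Y ⟫ ⊆ base B ×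
      (∀ s → ((s∈B , _) : s ∈ (B ∣ Y)) →
        f s s∈B ∈ ⟪ Y ⟫ → f s s∈B ∈ ⟦ s ⟧)
  }

-- Partial recursive functions relative to an oracle: programs (Kleene's
-- schemes plus a query to the oracle) and their big-step semantics.

data Program : ℕ → Set where
  zer   : Program 0
  succ  : Program 1
  proj  : ∀ {n} → Fin n → Program n
  query : Program 1
  comp  : ∀ {m n} → Program m → Vec (Program n) m → Program n
  prec  : ∀ {n} → Program n → Program (2 + n) → Program (1 + n)
  mu    : ∀ {n} → Program (1 + n) → Program n

χ : Subset → ℕ → ℕ
χ A n = if A n then 1 else 0

infix 4 _⊢_·_⇓_

data _⊢_·_⇓_ (A : Subset) : ∀ {n} → Program n → Vec ℕ n → ℕ → Set where
  zer⇓      : A ⊢ zer · [] ⇓ 0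
  succ⇓     : ∀ {x} → A ⊢ succ · x ∷ [] ⇓ suc x
  proj⇓     : ∀ {n} {i : Fin n} {xs} → A ⊢ proj i · xs ⇓ lookup xs i
  query⇓    : ∀ {x} → A ⊢ query · x ∷ [] ⇓ χ A x
  comp⇓     : ∀ {m n} {p : Program m} {qs : Vec (Program n) m} {xs ys z} →
              Pointwise (λ q y → A ⊢ q · xs ⇓ y) qs ys →
              A ⊢ p · ys ⇓ z → A ⊢ comp p qs · xs ⇓ z
  precZero⇓ : ∀ {n} {p : Program n} {q xs y} →
              A ⊢ p · xs ⇓ y → A ⊢ prec p q · zero ∷ xs ⇓ y
  precSuc⇓  : ∀ {n} {p : Program n} {q xs k y z} →
              A ⊢ prec p q · k ∷ xs ⇓ y → A ⊢ q · k ∷ y ∷ xs ⇓ z →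
              A ⊢ prec p q · suc k ∷ xs ⇓ z
  mu⇓       : ∀ {n} {p : Program (1 + n)} {xs k} →
              A ⊢ p · k ∷ xs ⇓ 0 →
              (∀ i → i < k → ∃[ y ] A ⊢ p · i ∷ xs ⇓ suc y) →
              A ⊢ mu p · xs ⇓ k

TuringFunctional : Set
TuringFunctional = Program 1

-- Φ ⟨ A ⟩≃ C : the functional Φ is defined at A, with value Φ(A) = C.

_⟨_⟩≃_ : TuringFunctional → Subset → Subset → Set
Φ ⟨ A ⟩≃ C = ∀ n → A ⊢ Φ · n ∷ [] ⇓ χ C n

infix 4 _≤sW_

_≤sW_ : Problem → Problem → Set
Q ≤sW P =
  Σ[ Φ ∈ TuringFunctional ] Σ[ Ψ ∈ TuringFunctional ]
    (∀ (i : Q.Instance) (I : Subset) → Q.IsCodeOf I i →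
      Σ[ j ∈ P.Instance ] Σ[ J ∈ Subset ]
        P.IsCodeOf J j × Φ ⟨ I ⟩≃ J ×
        (∀ (Ŷ : Subset) → P.IsSolutionTo Ŷ j →
          Σ[ Y ∈ Subset ] Ψ ⟨ Ŷ ⟩≃ Y × Q.IsSolutionTo Y i))
  where
  module Q = Problem Q
  module P = Problem P

{-# OPTIONS --safe #-}

-- Given f, let g(s) be an element of t ∖ s, where t is the member of B of least
-- code with f(t) = f(s), provided that t ≠ s; such an element exists because B
-- is an antichain.  Let Y solve g and suppose that s, t ∈ B ∣ Y have the same
-- colour and code t < code s.  Then t is the set chosen for s, since f is
-- 2-bounded, so g(s) ∈ t ⊆ Y and g(s) ∉ s, a contradiction.  Hence Y solves f.

module Submission where

open import Defs
open import Level using (0ℓ)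
open import Data.Nat.Base using (ℕ)
open import Relation.Unary using (Pred)

open import Data.Bool.Base using (true; false)
open import Data.Bool.Properties using (T?)
open import Data.Fin.Base using (Fin)
open import Data.Fin.Patterns using (0F; 1F; 2F)
open import Data.List.Base using (List; []; _∷_; map)
open import Data.Nat.Properties
open import Data.List.Membership.DecPropositional _≟_ using (_∈?_)
open import Data.List.Membership.Propositional using (find) renaming (_∈_ to _∈ˡ_; _∉_ to _∉ˡ_)
open import Data.List.Relation.Unary.All as All using (All; []; _∷_)
open import Data.List.Relation.Unary.All.Properties using (¬All⇒Any¬; All¬⇒¬Any)
open import Data.List.Relation.Unary.AllPairs as AllPairs using (AllPairs; []; _∷_)
open import Data.List.Relation.Unary.Any using (here; there)
open import Data.List.Relation.Unary.Linked using (linked?)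
open import Data.List.Relation.Unary.Linked.Properties using (Linked⇒AllPairs)
open import Data.List.Relation.Unary.Unique.Propositional using (Unique)
open import Data.Nat.Base using (zero; suc; pred; _+_; _*_; _∸_; _^_; _≤_; _<_; _≮_; _≡ᵇ_; z≤n; s≤s)
open import Data.Nat.ListAction using (sum)
open import Data.Product.Base using (Σ-syntax; ∃-syntax; _×_; _,_; proj₁; proj₂)
open import Data.Sum.Base using (_⊎_; inj₁; inj₂)
open import Data.Vec.Base using (Vec; []; _∷_; lookup)
open import Data.Vec.Relation.Binary.Pointwise.Inductive using ([]; _∷_)
open import Function.Base using (_∘_; case_of_)
open import Function.Bundles using (mk⇔; module Equivalence)
open import Relation.Binary.Definitions using (tri<; tri≈; tri>)
open import Relation.Binary.PropositionalEquality
  using (_≡_; _≢_; refl; sym; trans; cong; cong₂; subst; module ≡-Reasoning)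
open import Relation.Nullary.Decidable.Core using (yes; no; recompute)
open import Relation.Nullary.Negation.Core using (contradiction)
open import Relation.Unary using (_∈_; _⊆_; _⊂_; _⊈_)

open Equivalence using (to; from)

-- Least zeros

-- A bounded search, by recursion on the bound. Positivity is expressed by a predecessor because the
-- second premise of `mu⇓` has that form.
searchBelow : (P : ℕ → ℕ) (n : ℕ) →
  (∃[ k ] P k ≡ 0 × (∀ i → i < k → ∃[ y ] P i ≡ suc y)) ⊎
  (∀ i → i < n → ∃[ y ] P i ≡ suc y)
searchBelow P zero = inj₂ λ _ ()
searchBelow P (suc n) with searchBelow P n
... | inj₁ found = inj₁ found
... | inj₂ none with P n in eq
...   | zero  = inj₁ (n , eq , none)
...   | suc y = inj₂ below
  where
  below : ∀ i → i < suc n → ∃[ y ] P i ≡ suc y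
  below i (s≤s i≤n) with m≤n⇒m<n∨m≡n i≤n
  ... | inj₁ i<n  = none i i<n
  ... | inj₂ refl = y , eq

least : (P : ℕ → ℕ) → ∃[ k ] P k ≡ 0 →
  ∃[ k ] P k ≡ 0 × (∀ i → i < k → ∃[ y ] P i ≡ suc y)
-- With the bound `suc k` a failed search would cover `k` itself, which is a zero.
least P (k , Pk≡0) with searchBelow P (suc k)
... | inj₁ found = found
... | inj₂ none with none k ≤-refl
...   | _ , Pk≡suc = contradiction (trans (sym Pk≡0) Pk≡suc) 0≢1+n

abstract

  μ : (P : ℕ → ℕ) → ∃[ k ] P k ≡ 0 → ℕ
  μ P ∃zero = proj₁ (least P ∃zero)

  μ-zero : (P : ℕ → ℕ) (∃zero : ∃[ k ] P k ≡ 0) → P (μ P ∃zero) ≡ 0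
  μ-zero P ∃zero = proj₁ (proj₂ (least P ∃zero))

  μ-below : (P : ℕ → ℕ) (∃zero : ∃[ k ] P k ≡ 0) → ∀ i → i < μ P ∃zero → ∃[ y ] P i ≡ suc y
  μ-below P ∃zero = proj₂ (proj₂ (least P ∃zero))

μ-least : (P : ℕ → ℕ) (∃zero : ∃[ k ] P k ≡ 0) → ∀ {i} → P i ≡ 0 → μ P ∃zero ≤ i
μ-least P ∃zero {i} Pi≡0 = ≮⇒≥ λ i<μ →
  0≢1+n (trans (sym Pi≡0) (proj₂ (μ-below P ∃zero i i<μ)))

-- Binary digits

parity : ℕ → ℕ
parity zero    = 0
parity (suc n) = 1 ∸ parity n

-- The half rounded down, which grows exactly when an odd number is passed. Recursion in steps of
-- one, here and in `parity`, fits the scheme `prec`.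
half : ℕ → ℕ
half zero    = 0
half (suc n) = parity n + half n

shift : ℕ → ℕ → ℕ
shift zero    n = n
shift (suc i) n = half (shift i n)

bit : ℕ → ℕ → ℕ
bit i n = parity (shift i n)

parity-01 : ∀ n → parity n ≡ 0 ⊎ parity n ≡ 1
parity-01 zero = inj₁ refl
parity-01 (suc n) with parity n | parity-01 n
... | _ | inj₁ refl = inj₂ refl
... | _ | inj₂ refl = inj₁ refl

parity-2+ : ∀ n → parity (2 + n) ≡ parity n
parity-2+ n with parity n | parity-01 n
... | _ | inj₁ refl = refl
... | _ | inj₂ refl = refl

half-2+ : ∀ n → half (2 + n) ≡ suc (half n)
half-2+ n with parity n | parity-01 n
... | _ | inj₁ refl = refl
... | _ | inj₂ refl = refl

2*suc+ : ∀ m n → 2 * suc m + n ≡ 2 + (2 * m + n)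
2*suc+ m n = cong (_+ n) (*-suc 2 m)

parity-2*+ : ∀ m n → parity (2 * m + n) ≡ parity n
parity-2*+ zero    n = refl
parity-2*+ (suc m) n = begin
  parity (2 * suc m + n)   ≡⟨ cong parity (2*suc+ m n) ⟩
  parity (2 + (2 * m + n)) ≡⟨ parity-2+ (2 * m + n) ⟩
  parity (2 * m + n)       ≡⟨ parity-2*+ m n ⟩
  parity n                 ∎
  where open ≡-Reasoning

half-2*+ : ∀ m n → half (2 * m + n) ≡ m + half n
half-2*+ zero    n = refl
half-2*+ (suc m) n = begin
  half (2 * suc m + n)   ≡⟨ cong half (2*suc+ m n) ⟩
  half (2 + (2 * m + n)) ≡⟨ half-2+ (2 * m + n) ⟩
  suc (half (2 * m + n)) ≡⟨ cong suc (half-2*+ m n) ⟩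
  suc (m + half n)       ∎
  where open ≡-Reasoning

parity-even : ∀ m → parity (2 * m) ≡ 0
parity-even m = trans (cong parity (sym (+-identityʳ (2 * m)))) (parity-2*+ m 0)

parity-odd : ∀ m → parity (1 + 2 * m) ≡ 1
parity-odd m = cong (1 ∸_) (parity-even m)

half-even : ∀ m → half (2 * m) ≡ m
half-even m = begin
  half (2 * m)     ≡⟨ cong half (sym (+-identityʳ (2 * m))) ⟩
  half (2 * m + 0) ≡⟨ half-2*+ m 0 ⟩
  m + 0            ≡⟨ +-identityʳ m ⟩
  m                ∎
  where open ≡-Reasoning

half-odd : ∀ m → half (1 + 2 * m) ≡ m
half-odd m = cong₂ _+_ (parity-even m) (half-even m)

parity+2*half : ∀ n → parity n + 2 * half n ≡ n
parity+2*half zero    = refl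
parity+2*half (suc n) with parity n | parity-01 n | parity+2*half n
... | _ | inj₁ refl | eq = cong suc eq
... | _ | inj₂ refl | eq = trans (*-suc 2 (half n)) (cong suc eq)

-- `shift` halves last, whereas an induction on the position of a digit has to halve first.
shift-half : ∀ i n → half (shift i n) ≡ shift i (half n)
shift-half zero    n = refl
shift-half (suc i) n = cong half (shift-half i n)

bit-suc : ∀ i n → bit (suc i) n ≡ bit i (half n)
bit-suc i n = cong parity (shift-half i n)

bit-2^+-same : ∀ x n → bit x n ≡ 0 → bit x (2 ^ x + n) ≡ 1
bit-2^+-same zero    n bit≡0 = cong (1 ∸_) bit≡0
bit-2^+-same (suc x) n bit≡0 = begin
  bit (suc x) (2 * 2 ^ x + n)  ≡⟨ bit-suc x (2 * 2 ^ x + n) ⟩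
  bit x (half (2 * 2 ^ x + n)) ≡⟨ cong (bit x) (half-2*+ (2 ^ x) n) ⟩
  bit x (2 ^ x + half n)       ≡⟨ bit-2^+-same x (half n) (trans (sym (bit-suc x n)) bit≡0) ⟩
  1                            ∎
  where open ≡-Reasoning

-- Adding `2 ^ x` to a number whose digit at `x` is 0 causes no carry. Halving lowers both positions
-- until one of them is the units place.
bit-2^+-other : ∀ x i n → i ≢ x → bit x n ≡ 0 → bit i (2 ^ x + n) ≡ bit i n
bit-2^+-other zero    zero    n i≢x bit≡0 = contradiction refl i≢x
-- Here n is even, so n and its successor have the same half.
bit-2^+-other zero    (suc i) n i≢x bit≡0 = begin
  bit (suc i) (1 + n)       ≡⟨ bit-suc i (1 + n) ⟩
  bit i (parity n + half n) ≡⟨ cong (λ p → bit i (p + half n)) bit≡0 ⟩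
  bit i (half n)            ≡⟨ bit-suc i n ⟨
  bit (suc i) n             ∎
  where open ≡-Reasoning
bit-2^+-other (suc x) zero    n i≢x bit≡0 = parity-2*+ (2 ^ x) n
bit-2^+-other (suc x) (suc i) n i≢x bit≡0 = begin
  bit (suc i) (2 * 2 ^ x + n)  ≡⟨ bit-suc i (2 * 2 ^ x + n) ⟩
  bit i (half (2 * 2 ^ x + n)) ≡⟨ cong (bit i) (half-2*+ (2 ^ x) n) ⟩
  bit i (2 ^ x + half n)       ≡⟨ bit-2^+-other x i (half n) (i≢x ∘ cong suc)
                                    (trans (sym (bit-suc x n)) bit≡0) ⟩
  bit i (half n)               ≡⟨ bit-suc i n ⟨
  bit (suc i) n                ∎
  where open ≡-Reasoning

-- Canonical indices

bits : List ℕ → ℕ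
bits xs = sum (map (2 ^_) xs)

bit-zero : ∀ i → bit i 0 ≡ 0
bit-zero zero    = refl
bit-zero (suc i) = trans (bit-suc i 0) (bit-zero i)

-- Without repetitions, the digit at the head x is still 0 in the sum over the tail, so that adding
-- `2 ^ x` changes no other digit.
∉⇒bit≡0 : ∀ {xs i} → Unique xs → i ∉ˡ xs → bit i (bits xs) ≡ 0
∉⇒bit≡0 {i = i} [] _ = bit-zero i
∉⇒bit≡0 {x ∷ xs} {i} (x∉xs ∷ unique) i∉ =
  trans (bit-2^+-other x i (bits xs) (i∉ ∘ here) (∉⇒bit≡0 unique (All¬⇒¬Any x∉xs)))
        (∉⇒bit≡0 unique (i∉ ∘ there))

∈⇒bit≡1 : ∀ {xs i} → Unique xs → i ∈ˡ xs → bit i (bits xs) ≡ 1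
∈⇒bit≡1 {x ∷ xs} (x∉xs ∷ unique) (here refl) =
  bit-2^+-same x (bits xs) (∉⇒bit≡0 unique (All¬⇒¬Any x∉xs))
∈⇒bit≡1 {x ∷ xs} {i} (x∉xs ∷ unique) (there i∈xs) =
  trans (bit-2^+-other x i (bits xs) (λ { refl → All¬⇒¬Any x∉xs i∈xs })
          (∉⇒bit≡0 unique (All¬⇒¬Any x∉xs)))
        (∈⇒bit≡1 unique i∈xs)

bit≡1⇒∈ : ∀ {xs i} → Unique xs → bit i (bits xs) ≡ 1 → i ∈ˡ xs
bit≡1⇒∈ {xs} {i} unique bit≡1 with i ∈? xs
... | yes i∈xs = i∈xs
... | no  i∉xs = contradiction (trans (sym (∉⇒bit≡0 unique i∉xs)) bit≡1) 0≢1+n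

n<2^n : ∀ n → n < 2 ^ n
n<2^n zero    = s≤s z≤n
n<2^n (suc n) = ≤-trans (+-mono-≤ (m^n>0 2 n) (n<2^n n)) (+-monoʳ-≤ (2 ^ n) (m≤m+n (2 ^ n) 0))

-- Allows a search through the elements of a set to be cut off at the index of the set.
∈⇒<bits : ∀ {xs i} → i ∈ˡ xs → i < bits xs
∈⇒<bits {x ∷ xs} (here refl)  = ≤-trans (n<2^n x) (m≤m+n (2 ^ x) (bits xs))
∈⇒<bits {x ∷ xs} (there i∈xs) = ≤-trans (∈⇒<bits i∈xs) (m≤n+m (bits xs) (2 ^ x))

increasing-unique : ∀ {xs} → AllPairs _<_ xs → Unique xs
increasing-unique = AllPairs.map <⇒≢

∈-∷⁻ : ∀ {x y z xs ys} → (∀ {z} → z ∈ˡ x ∷ xs → z ∈ˡ y ∷ ys) → x ≡ y → All (x <_) xs →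
  z ∈ˡ xs → z ∈ˡ ys
∈-∷⁻ sub refl x<xs z∈xs with sub (there z∈xs)
... | here refl  = contradiction (All.lookup x<xs z∈xs) (<-irrefl refl)
... | there z∈ys = z∈ys

increasing-head-≤ : ∀ {x y xs} → All (x <_) xs → y ∈ˡ x ∷ xs → x ≤ y
increasing-head-≤ x<xs (here refl)  = ≤-refl
increasing-head-≤ x<xs (there y∈xs) = <⇒≤ (All.lookup x<xs y∈xs)

-- Each head is the minimum of its list, so the heads agree; neither recurs later, so the tails
-- again have the same elements.
increasing-ext : ∀ {xs ys} → AllPairs _<_ xs → AllPairs _<_ ys →
  (∀ {z} → z ∈ˡ xs → z ∈ˡ ys) → (∀ {z} → z ∈ˡ ys → z ∈ˡ xs) → xs ≡ ys
increasing-ext [] [] _ _ = refl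
increasing-ext [] (_ ∷ _) _ sup = case sup (here refl) of λ ()
increasing-ext (_ ∷ _) [] sub _ = case sub (here refl) of λ ()
increasing-ext (x<xs ∷ xs↗) (y<ys ∷ ys↗) sub sup =
  cong₂ _∷_ x≡y (increasing-ext xs↗ ys↗ (∈-∷⁻ sub x≡y x<xs) (∈-∷⁻ sup (sym x≡y) y<ys))
  where
  x≡y = ≤-antisym (increasing-head-≤ x<xs (sup (here refl))) (increasing-head-≤ y<ys (sub (here refl)))

elements-increasing : ∀ s → AllPairs _<_ (elements s)
-- The stored proof is irrelevant; a relevant one is recovered by decidability.
elements-increasing (finSet xs xs↗) = Linked⇒AllPairs <-trans (recompute (linked? _<?_ xs) xs↗)

elements-unique : ∀ s → Unique (elements s)
elements-unique s = increasing-unique (elements-increasing s)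

elements-injective : ∀ {s t} → elements s ≡ elements t → s ≡ t
elements-injective refl = refl

-- The elements are the positions of the binary digits 1 of the index.
code-injective : ∀ {s t} → code s ≡ code t → s ≡ t
code-injective {s} {t} eq = elements-injective
  (increasing-ext (elements-increasing s) (elements-increasing t) (sub s t eq) (sub t s (sym eq)))
  where
  sub : ∀ s t → code s ≡ code t → ⟦ s ⟧ ⊆ ⟦ t ⟧
  sub s t eq {z} z∈s =
    bit≡1⇒∈ (elements-unique t) (trans (cong (bit z) (sym eq)) (∈⇒bit≡1 (elements-unique s) z∈s))

-- Unpairing

root-exists : ∀ m → ∃[ r ] (1 + m) ∸ (1 + r) * (1 + r) ≡ 0
root-exists m = m , m≤n⇒m∸n≡0 (m≤m*n (1 + m) (1 + m))

-- The integer square root: the least r for which m is less than the square of 1 + r.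
root : ℕ → ℕ
root m = μ (λ r → (1 + m) ∸ (1 + r) * (1 + r)) (root-exists m)

left : ℕ → ℕ
left m = m ∸ root m * root m

right : ℕ → ℕ
right m = root m ∸ left m

-- The summand c is at most c + y, so it does not lift the square of c + y to the next square.
root-pair : ∀ c y → root (pair c y) ≡ c + y
root-pair c y = ≤-antisym
  (μ-least P (root-exists (pair c y)) (m≤n⇒m∸n≡0 pair<))
  (≮⇒≥ λ r<c+y → <⇒≱ (m∸n≡0⇒m≤n {1 + pair c y} (μ-zero P (root-exists (pair c y))))
    (≤-trans (*-mono-≤ r<c+y r<c+y) (m≤m+n _ c)))
  where
  P = λ r → (1 + pair c y) ∸ (1 + r) * (1 + r)

  pair< : pair c y < (1 + (c + y)) * (1 + (c + y))
  pair< = begin-strict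
    (c + y) * (c + y) + c                   ≤⟨ +-monoʳ-≤ _ (m≤m+n c y) ⟩
    (c + y) * (c + y) + (c + y)             ≡⟨ +-comm _ (c + y) ⟩
    (c + y) + (c + y) * (c + y)             ≡⟨ *-suc (c + y) (c + y) ⟨
    (c + y) * (1 + (c + y))                 <⟨ m<n+m _ (s≤s z≤n) ⟩
    (1 + (c + y)) + (c + y) * (1 + (c + y)) ∎
    where open ≤-Reasoning

left-pair : ∀ c y → left (pair c y) ≡ c
left-pair c y rewrite root-pair c y = m+n∸m≡n ((c + y) * (c + y)) c

right-pair : ∀ c y → right (pair c y) ≡ y
right-pair c y rewrite left-pair c y | root-pair c y = m+n∸m≡n c y

pair-injective : ∀ c y c′ y′ → pair c y ≡ pair c′ y′ → c ≡ c′ × y ≡ y′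
pair-injective c y c′ y′ eq =
  trans (sym (left-pair c y)) (trans (cong left eq) (left-pair c′ y′)) ,
  trans (sym (right-pair c y)) (trans (cong right eq) (right-pair c′ y′))

-- Number-valued tests

dist : ℕ → ℕ → ℕ
dist m n = (m ∸ n) + (n ∸ m)

dist≡0⇒≡ : ∀ m n → dist m n ≡ 0 → m ≡ n
dist≡0⇒≡ m n eq = ≤-antisym (m∸n≡0⇒m≤n (m+n≡0⇒m≡0 (m ∸ n) eq)) (m∸n≡0⇒m≤n (m+n≡0⇒n≡0 (m ∸ n) eq))

dist-refl : ∀ n → dist n n ≡ 0
dist-refl n = cong₂ _+_ (n∸n≡0 n) (n∸n≡0 n)

-- In what follows a number-valued predicate holds where it takes the value 0.

absent : Subset → ℕ → ℕ
absent A n = 1 ∸ χ A n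

∈⇒absent≡0 : ∀ A {n} → n ∈ ⟪ A ⟫ → absent A n ≡ 0
∈⇒absent≡0 A {n} n∈A with A n
... | true = refl

absent≡0⇒∈ : ∀ A n → absent A n ≡ 0 → n ∈ ⟪ A ⟫
absent≡0⇒∈ A n eq with A n
... | true = _

zeros : (ℕ → ℕ) → Subset
zeros P n = P n ≡ᵇ 0

χ-zeros : ∀ P n → χ (zeros P) n ≡ 1 ∸ P n
χ-zeros P n with P n
... | zero  = refl
... | suc m = sym (0∸n≡0 m)

-- Functions computed by one program uniformly in the oracle

module Uniform {O : Set} (oracle : O → Subset) where

  record Computable {n} (F : O → Vec ℕ n → ℕ) : Set where
    field
      program  : Program n
      computes : ∀ o xs → oracle o ⊢ program · xs ⇓ F o xs

  -- The curried forms serve as outer functions of a composition; the inner functions act on a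
  -- vector of variables.
  record Computable₁ (f : O → ℕ → ℕ) : Set where
    field
      program  : Program 1
      computes : ∀ o x → oracle o ⊢ program · x ∷ [] ⇓ f o x

  record Computable₂ (f : O → ℕ → ℕ → ℕ) : Set where
    field
      program  : Program 2
      computes : ∀ o x y → oracle o ⊢ program · x ∷ y ∷ [] ⇓ f o x y

  open Computable
  open Computable₁
  open Computable₂

  function₁ : ∀ {F} → Computable F → Computable₁ (λ o x → F o (x ∷ []))
  function₁ p = record { program = program p ; computes = λ o x → computes p o (x ∷ []) }

  function₂ : ∀ {F} → Computable F → Computable₂ (λ o x y → F o (x ∷ y ∷ []))
  function₂ p = record { program = program p ; computes = λ o x y → computes p o (x ∷ y ∷ []) }

  ext₁ : ∀ {f g} → (∀ o x → f o x ≡ g o x) → Computable₁ f → Computable₁ g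
  ext₁ f≡g p = record
    { program  = program p
    ; computes = λ o x → subst (λ y → oracle o ⊢ program p · x ∷ [] ⇓ y) (f≡g o x) (computes p o x)
    }

  var : ∀ {n} (i : Fin n) → Computable (λ _ xs → lookup xs i)
  var i = record { program = proj i ; computes = λ _ _ → proj⇓ }

  infixl 5 _$₁_ _$₂_,_

  _$₁_ : ∀ {n f} {a : O → Vec ℕ n → ℕ} →
    Computable₁ f → Computable a → Computable (λ o xs → f o (a o xs))
  p $₁ q = record
    { program  = comp (program p) (program q ∷ [])
    ; computes = λ o xs → comp⇓ (computes q o xs ∷ []) (computes p o _)
    }

  _$₂_,_ : ∀ {n f} {a b : O → Vec ℕ n → ℕ} →
    Computable₂ f → Computable a → Computable b → Computable (λ o xs → f o (a o xs) (b o xs))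
  p $₂ q , r = record
    { program  = comp (program p) (program q ∷ program r ∷ [])
    ; computes = λ o xs → comp⇓ (computes q o xs ∷ computes r o xs ∷ []) (computes p o _ _)
    }

  suc-computable : Computable₁ (λ _ → suc)
  suc-computable = record { program = succ ; computes = λ _ _ → succ⇓ }

  const : ∀ {n} k → Computable {n} (λ _ _ → k)
  const zero    = record { program = comp zer [] ; computes = λ _ _ → comp⇓ [] zer⇓ }
  const (suc k) = suc-computable $₁ const k

  χ-computable : Computable₁ (χ ∘ oracle)
  χ-computable = record { program = query ; computes = λ _ _ → query⇓ }

  primRec₁ : ∀ (f : O → ℕ → ℕ) {k step} → (∀ o → f o 0 ≡ k) →
    Computable₂ step → (∀ o x → f o (suc x) ≡ step o x (f o x)) → Computable₁ f
  primRec₁ f {k} {step} f0 p fsuc = record { program = prec (program (const k)) (program p) ; computes = go }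
    where
    go : ∀ o x → oracle o ⊢ prec (program (const k)) (program p) · x ∷ [] ⇓ f o x
    go o zero    rewrite f0 o     = precZero⇓ (computes (const k) o [])
    go o (suc x) rewrite fsuc o x = precSuc⇓ (go o x) (computes p o x (f o x))

  primRec₂ : ∀ (f : O → ℕ → ℕ → ℕ) {base step} →
    Computable₁ base → (∀ o y → f o 0 y ≡ base o y) →
    Computable {3} step → (∀ o x y → f o (suc x) y ≡ step o (x ∷ f o x y ∷ y ∷ [])) → Computable₂ f
  primRec₂ f {base} {step} p f0 q fsuc = record { program = prec (program p) (program q) ; computes = go }
    where
    go : ∀ o x y → oracle o ⊢ prec (program p) (program q) · x ∷ y ∷ [] ⇓ f o x y
    go o zero    y rewrite f0 o y     = precZero⇓ (computes p o y)
    go o (suc x) y rewrite fsuc o x y = precSuc⇓ (go o x y) (computes q o (x ∷ f o x y ∷ y ∷ []))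

  -- The two properties of `μ` are the two premises of `mu⇓`. A zero for every oracle and argument
  -- makes the program total.
  minimise : ∀ {P} (∃zero : ∀ o x → ∃[ k ] P o k x ≡ 0) →
    Computable₂ P → Computable₁ (λ o x → μ (λ k → P o k x) (∃zero o x))
  minimise {P} ∃zero p = record
    { program  = mu (program p)
    ; computes = λ o x → mu⇓
        (value o _ x (μ-zero _ (∃zero o x)))
        (λ i i<μ → let y , eq = μ-below _ (∃zero o x) i i<μ in y , value o i x eq)
    }
    where
    value : ∀ o k x {y} → P o k x ≡ y → oracle o ⊢ program p · k ∷ x ∷ [] ⇓ y
    value o k x refl = computes p o k x

  +-computable : Computable₂ (λ _ → _+_)
  +-computable = primRec₂ _ (function₁ (var 0F)) (λ _ _ → refl)
    (suc-computable $₁ var 1F) (λ _ _ _ → refl)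

  *-computable : Computable₂ (λ _ → _*_)
  *-computable = primRec₂ _ (function₁ (const 0)) (λ _ _ → refl)
    (+-computable $₂ var 2F , var 1F) (λ _ _ _ → refl)

  pred-computable : Computable₁ (λ _ → pred)
  pred-computable = primRec₁ _ (λ _ → refl) (function₂ (var 0F)) (λ _ _ → refl)

  ∸-computable : Computable₂ (λ _ → _∸_)
  ∸-computable = function₂ (flipped $₂ var 1F , var 0F)
    where
    -- `prec` recurs on the first argument, whereas iterating `pred` recurs on the number
    -- subtracted.
    flipped : Computable₂ (λ _ y x → x ∸ y)
    flipped = primRec₂ _ (function₁ (var 0F)) (λ _ _ → refl)
      (pred-computable $₁ var 1F) (λ _ y x → sym (pred[m∸n]≡m∸[1+n] x y))

  parity-computable : Computable₁ (λ _ → parity)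
  parity-computable = primRec₁ _ (λ _ → refl)
    (function₂ (∸-computable $₂ const 1 , var 1F)) (λ _ _ → refl)

  half-computable : Computable₁ (λ _ → half)
  half-computable = primRec₁ _ (λ _ → refl)
    (function₂ (+-computable $₂ (parity-computable $₁ var 0F) , var 1F)) (λ _ _ → refl)

  bit-computable : Computable₂ (λ _ → bit)
  bit-computable = function₂ (parity-computable $₁ (shift-computable $₂ var 0F , var 1F))
    where
    shift-computable : Computable₂ (λ _ → shift)
    shift-computable = primRec₂ _ (function₁ (var 0F)) (λ _ _ → refl)
      (half-computable $₁ var 1F) (λ _ _ _ → refl)

  double-computable : Computable₁ (λ _ x → 2 * x)
  double-computable = function₁ (*-computable $₂ const 2 , var 0F)

  square-computable : Computable₁ (λ _ x → x * x)
  square-computable = function₁ (*-computable $₂ var 0F , var 0F)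

  pair-computable : Computable₂ (λ _ → pair)
  pair-computable = function₂
    (+-computable $₂ (square-computable $₁ (+-computable $₂ var 0F , var 1F)) , var 0F)

  root-computable : Computable₁ (λ _ → root)
  root-computable = minimise (λ _ → root-exists) (function₂
    (∸-computable $₂ (suc-computable $₁ var 1F)
                   , (square-computable $₁ (suc-computable $₁ var 0F))))

  left-computable : Computable₁ (λ _ → left)
  left-computable = function₁
    (∸-computable $₂ var 0F , (square-computable $₁ (root-computable $₁ var 0F)))

  right-computable : Computable₁ (λ _ → right)
  right-computable = function₁
    (∸-computable $₂ (root-computable $₁ var 0F) , (left-computable $₁ var 0F))

  dist-computable : Computable₂ (λ _ → dist)
  dist-computable = function₂
    (+-computable $₂ (∸-computable $₂ var 0F , var 1F) , (∸-computable $₂ var 1F , var 0F))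

  not-computable : Computable₁ (λ _ n → 1 ∸ n)
  not-computable = function₁ (∸-computable $₂ const 1 , var 0F)

  absent-computable : Computable₁ (absent ∘ oracle)
  absent-computable = function₁ (not-computable $₁ (χ-computable $₁ var 0F))

-- Elements separating two members of a barrier

-- Inclusion of finite sets is decidable. If it fails, a witness can be found; if it held, it would
-- be strict by extensionality, against the antichain condition.
antichain-witness : ∀ {B X} → B IsBarrierOn X → ∀ {s t} → s ∈ B → t ∈ B → s ≢ t →
  ∃[ i ] i ∈ˡ elements s × i ∉ˡ elements t
antichain-witness barrier {s} {t} s∈B t∈B s≢t with All.all? (_∈? elements t) (elements s)
... | no s⊈t = find (¬All⇒Any¬ (_∈? elements t) (elements s) s⊈t)
... | yes s⊆t = contradiction s⊂t (antichain s t s∈B t∈B)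
  where
  open _IsBarrierOn_ barrier using (antichain)
  t⊈s : ⟦ t ⟧ ⊈ ⟦ s ⟧
  t⊈s t⊆s = s≢t (elements-injective
    (increasing-ext (elements-increasing s) (elements-increasing t) (All.lookup s⊆t) t⊆s))
  s⊂t : ⟦ s ⟧ ⊂ ⟦ t ⟧
  s⊂t = All.lookup s⊆t , t⊈s

-- Holds if i belongs to the set with index d but not to that with index c;
-- the factor d ∸ i stops the search at d, which is then the value of separator c d
-- if the first set is contained in the second.

separates : ℕ → ℕ → ℕ → ℕ
separates c d i = (d ∸ i) * (1 ∸ bit i d * (1 ∸ bit i c))

-- Below `code t` the cut-off factor is positive, so the factor that compares digits vanishes.
separates-sound : ∀ s t {i} → i < code t → separates (code s) (code t) i ≡ 0 →
  i ∈ˡ elements t × i ∉ˡ elements s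
separates-sound s t {i} i<t eq with m*n≡0⇒m≡0∨n≡0 (code t ∸ i) eq
... | inj₁ t∸i≡0 = contradiction (m∸n≡0⇒m≤n t∸i≡0) (<⇒≱ i<t)
... | inj₂ bits≡0 = i∈t , i∉s
  where
  i∈t : i ∈ˡ elements t
  i∈t with i ∈? elements t
  ... | yes i∈t = i∈t
  ... | no  i∉t = contradiction
    (trans (sym bits≡0) (cong (λ b → 1 ∸ b * (1 ∸ bit i (code s))) (∉⇒bit≡0 (elements-unique t) i∉t)))
    0≢1+n
  i∉s : i ∉ˡ elements s
  i∉s i∈s = 0≢1+n (begin
    0                                         ≡⟨ bits≡0 ⟨
    1 ∸ bit i (code t) * (1 ∸ bit i (code s)) ≡⟨ cong (λ b → 1 ∸ bit i (code t) * (1 ∸ b))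
                                                     (∈⇒bit≡1 (elements-unique s) i∈s) ⟩
    1 ∸ bit i (code t) * 0                    ≡⟨ cong (1 ∸_) (*-zeroʳ (bit i (code t))) ⟩
    1                                         ∎)
    where open ≡-Reasoning

separates-complete : ∀ s t {i} → i ∈ˡ elements t → i ∉ˡ elements s →
  separates (code s) (code t) i ≡ 0
separates-complete s t {i} i∈t i∉s
  rewrite ∈⇒bit≡1 (elements-unique t) i∈t | ∉⇒bit≡0 (elements-unique s) i∉s = *-zeroʳ (code t ∸ i)

separator-exists : ∀ c d → ∃[ i ] separates c d i ≡ 0
separator-exists c d = d , cong (_* (1 ∸ bit d d * (1 ∸ bit d c))) (n∸n≡0 d)

separator : ℕ → ℕ → ℕ
separator c d = μ (separates c d) (separator-exists c d)

-- The given element is a zero below `code t`, so the least zero also lies below the cut-off and is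
-- a genuine witness.
separator-code : ∀ s t → ∃[ i ] i ∈ˡ elements t × i ∉ˡ elements s →
  separator (code s) (code t) ∈ˡ elements t × separator (code s) (code t) ∉ˡ elements s
separator-code s t (i , i∈t , i∉s) = separates-sound s t
  (≤-<-trans (μ-least _ (separator-exists (code s) (code t)) (separates-complete s t i∈t i∉s)) (∈⇒<bits i∈t))
  (μ-zero _ (separator-exists (code s) (code t)))

-- Reading a colouring from its code

module Reduction (B : Pred FinSet 0ℓ) where

  CodedColoring : Set
  CodedColoring = Σ[ f ∈ Coloring B ] Σ[ I ∈ Subset ] I Codes f

  coloring : CodedColoring → Coloring B
  coloring (f , _) = f

  oracle : CodedColoring → Subset
  oracle (_ , I , _) = I

  open Uniform oracle

  domain-code : ∀ o {s} → s ∈ B → 2 * code s ∈ ⟪ oracle o ⟫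
  domain-code (_ , _ , codes) {s} s∈B = from (codes _) (inj₁ (s , s∈B , refl))

  -- By parity an even element of the code cannot come from the graph.
  domain-decode : ∀ o c → 2 * c ∈ ⟪ oracle o ⟫ → ∃[ s ] s ∈ B × code s ≡ c
  domain-decode (f , _ , codes) c 2c∈I with to (codes _) 2c∈I
  ... | inj₁ (s , s∈B , eq) = s , s∈B , *-cancelˡ-≡ (code s) c 2 (sym eq)
  ... | inj₂ (s , s∈B , eq) = contradiction eq (even≢odd c (pair (code s) (f s s∈B)))

  graph-code : ∀ o {s} (s∈B : s ∈ B) → 1 + 2 * pair (code s) (coloring o s s∈B) ∈ ⟪ oracle o ⟫
  graph-code (_ , _ , codes) {s} s∈B = from (codes _) (inj₂ (s , s∈B , refl))

  graph-decode : ∀ o c x → 1 + 2 * pair c x ∈ ⟪ oracle o ⟫ →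
    ∃[ s ] Σ[ s∈B ∈ s ∈ B ] code s ≡ c × coloring o s s∈B ≡ x
  graph-decode (f , _ , codes) c x ∈I with to (codes _) ∈I
  ... | inj₁ (s , s∈B , eq) = contradiction (sym eq) (even≢odd (code s) (pair c x))
  ... | inj₂ (s , s∈B , eq)
    with c≡ , x≡ ← pair-injective c x (code s) (f s s∈B) (*-cancelˡ-≡ _ _ 2 (suc-injective eq))
    = s , s∈B , sym c≡ , sym x≡

  -- The factor χ I (2 c) makes the search for a colour terminate on a number c
  -- which is not the code of a member of B.

  colored : CodedColoring → ℕ → ℕ → ℕ → ℕ
  colored o c d x = χ (oracle o) (2 * c) * absent (oracle o) (1 + 2 * pair d x)

  colored-code : ∀ o {c s} (s∈B : s ∈ B) → colored o c (code s) (coloring o s s∈B) ≡ 0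
  colored-code o {c} s∈B
    rewrite ∈⇒absent≡0 (oracle o) (graph-code o s∈B) = *-zeroʳ (χ (oracle o) (2 * c))

  colored-decode : ∀ o {s d x} → s ∈ B → colored o (code s) d x ≡ 0 →
    ∃[ t ] Σ[ t∈B ∈ t ∈ B ] code t ≡ d × coloring o t t∈B ≡ x
  colored-decode o {s} {d} {x} s∈B eq with oracle o (2 * code s) | domain-code o s∈B
  ... | true | _ = graph-decode o d x (absent≡0⇒∈ (oracle o) (1 + 2 * pair d x) (trans (sym (+-identityʳ _)) eq))

  -- Searching for colours and for sets of equal colour

  color-exists : ∀ o c → ∃[ x ] colored o c c x ≡ 0
  color-exists o c with T? (oracle o (2 * c))
  ... | yes 2c∈I with s , s∈B , refl ← domain-decode o c 2c∈I =
    coloring o s s∈B , colored-code o {code s} s∈B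
  ... | no 2c∉I with oracle o (2 * c)
  ...   | true  = contradiction _ 2c∉I
  ...   | false = 0 , refl

  color : CodedColoring → ℕ → ℕ
  color o c = μ (colored o c c) (color-exists o c)

  -- The graph holds one colour for `code s`, since `code` is injective and colours do not depend on
  -- the proof of membership.
  color-code : ∀ o {s} (s∈B : s ∈ B) → color o (code s) ≡ coloring o s s∈B
  color-code o {s} s∈B
    with t , t∈B , eq , ft≡ ← colored-decode o s∈B
           (μ-zero (colored o (code s) (code s)) (color-exists o (code s)))
    with refl ← code-injective {t} {s} eq = sym ft≡

  -- A set shares its colour with itself.
  partner-exists : ∀ o c → ∃[ d ] colored o c d (color o c) ≡ 0
  partner-exists o c = c , μ-zero (colored o c c) (color-exists o c)

  partner : CodedColoring → ℕ → ℕ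
  partner o c = μ (λ d → colored o c d (color o c)) (partner-exists o c)

  partner-decode : ∀ o {s} (s∈B : s ∈ B) →
    ∃[ t ] Σ[ t∈B ∈ t ∈ B ] code t ≡ partner o (code s) × coloring o t t∈B ≡ coloring o s s∈B
  partner-decode o {s} s∈B
    with t , t∈B , eq , ft≡ ← colored-decode o s∈B
           (μ-zero (λ d → colored o (code s) d (color o (code s))) (partner-exists o (code s)))
    = t , t∈B , eq , trans ft≡ (color-code o s∈B)

  partner-≤ : ∀ o {s t} (s∈B : s ∈ B) (t∈B : t ∈ B) → coloring o t t∈B ≡ coloring o s s∈B →
    partner o (code s) ≤ code t
  partner-≤ o {s} {t} s∈B t∈B ft≡fs = μ-least _ (partner-exists o (code s))
    (subst (λ x → colored o (code s) (code t) x ≡ 0) (trans ft≡fs (sym (color-code o s∈B)))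
      (colored-code o {code s} t∈B))

  -- Let u be the set of least code with this colour. Then u differs from s, as its code is at most
  -- `code t`; if it also differed from t, three sets would share a colour.
  partner-unique : ∀ o → Bounded 2 (coloring o) → ∀ {s t} (s∈B : s ∈ B) (t∈B : t ∈ B) →
    coloring o t t∈B ≡ coloring o s s∈B → code t < code s → partner o (code s) ≡ code t
  partner-unique o bounded {s} {t} s∈B t∈B ft≡fs t<s
    with u , u∈B , cu≡ , fu≡fs ← partner-decode o s∈B
    with code u ≟ code t
  ... | yes cu≡ct = trans (sym cu≡) cu≡ct
  ... | no  cu≢ct = contradiction
    (bounded _ (u ∷ t ∷ s ∷ [])
      ((u≢t ∷ u≢s ∷ []) ∷ (t≢s ∷ []) ∷ [] ∷ [])
      ((u∈B , fu≡fs) ∷ (t∈B , ft≡fs) ∷ (s∈B , refl) ∷ []))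
    (λ { (s≤s (s≤s ())) })
    where
    u≢t : u ≢ t
    u≢t = cu≢ct ∘ cong code
    t≢s : t ≢ s
    t≢s = <⇒≢ t<s ∘ cong code
    u≢s : u ≢ s
    u≢s = <⇒≢ (≤-<-trans (≤-trans (≤-reflexive cu≡) (partner-≤ o s∈B t∈B ft≡fs)) t<s) ∘ cong code

  -- If a member of B is its own partner, the search ends at its cut-off, here c. This default is
  -- harmless: `no-collision` evaluates the new colouring only at the set of larger code, whose
  -- partner is the other set.
  avoid : CodedColoring → ℕ → ℕ
  avoid o c = separator c (partner o c)

  -- The code of the new colouring

  byCode : (ℕ → ℕ) → Coloring B
  byCode g s _ = g (code s)

  module _ (o : CodedColoring) (g : ℕ → ℕ) where

    -- A sum vanishes exactly when all its terms do, so addition acts as conjunction.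
    mismatch : ℕ → ℕ → ℕ → ℕ
    mismatch m c y = dist m (pair c y) + (absent (oracle o) (2 * c) + dist (g c) y)

    mismatch-sound : ∀ m c y → mismatch m c y ≡ 0 →
      ∃[ s ] s ∈ B × m ≡ pair (code s) (g (code s))
    mismatch-sound m c y eq =
      let m≡pair           = dist≡0⇒≡ m (pair c y) (m+n≡0⇒m≡0 (dist m (pair c y)) eq)
          rest             = m+n≡0⇒n≡0 (dist m (pair c y)) eq
          2c∈I             = absent≡0⇒∈ (oracle o) (2 * c) (m+n≡0⇒m≡0 (absent (oracle o) (2 * c)) rest)
          g≡y              = dist≡0⇒≡ (g c) y (m+n≡0⇒n≡0 (absent (oracle o) (2 * c)) rest)
          s , s∈B , code≡c = domain-decode o c 2c∈I
      in s , s∈B , trans m≡pair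
           (trans (cong (pair c) (sym g≡y)) (cong (λ c → pair c (g c)) (sym code≡c)))

    mismatch-complete : ∀ {s} → s ∈ B →
      mismatch (pair (code s) (g (code s))) (code s) (g (code s)) ≡ 0
    mismatch-complete {s} s∈B =
      cong₂ _+_ (dist-refl (pair (code s) (g (code s))))
        (cong₂ _+_ (∈⇒absent≡0 (oracle o) (domain-code o s∈B)) (dist-refl (g (code s))))

    -- Unpairing yields candidates for every m; if m is not a pair, the first summand of `mismatch`
    -- is positive.
    notInGraph : ℕ → ℕ
    notInGraph m = mismatch m (left m) (right m)

    notInGraph-complete : ∀ {s} → s ∈ B → notInGraph (pair (code s) (g (code s))) ≡ 0
    notInGraph-complete {s} s∈B =
      trans (cong₂ (mismatch m) (left-pair (code s) (g (code s))) (right-pair (code s) (g (code s))))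
        (mismatch-complete s∈B)
      where m = pair (code s) (g (code s))

    -- A case distinction on parity. Even numbers are tested against the oracle itself, since both
    -- colourings have domain B; odd numbers are tested against the new graph.
    nonMember : ℕ → ℕ
    nonMember k = parity k * notInGraph (half k) + (1 ∸ parity k) * absent (oracle o) k

    nonMember-even : ∀ k → parity k ≡ 0 → nonMember k ≡ absent (oracle o) k
    nonMember-even k even =
      trans (cong (λ p → p * notInGraph (half k) + (1 ∸ p) * absent (oracle o) k) even)
        (+-identityʳ (absent (oracle o) k))

    nonMember-odd : ∀ k → parity k ≡ 1 → nonMember k ≡ notInGraph (half k)
    nonMember-odd k odd =
      trans (cong (λ p → p * notInGraph (half k) + (1 ∸ p) * absent (oracle o) k) odd)
        (trans (+-identityʳ (notInGraph (half k) + 0)) (+-identityʳ (notInGraph (half k))))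

    nonMember-sound : ∀ k → nonMember k ≡ 0 →
      (∃[ s ] s ∈ B × k ≡ 2 * code s) ⊎ (∃[ s ] s ∈ B × k ≡ 1 + 2 * pair (code s) (g (code s)))
    nonMember-sound k eq = case parity-01 k of λ where
      (inj₁ even) →
        let k≡2*half            = trans (sym (parity+2*half k)) (cong (_+ 2 * half k) even)
            k∈I                 = absent≡0⇒∈ (oracle o) k (trans (sym (nonMember-even k even)) eq)
            s , s∈B , code≡half = domain-decode o (half k) (subst (_∈ ⟪ oracle o ⟫) k≡2*half k∈I)
        in inj₁ (s , s∈B , trans k≡2*half (cong (2 *_) (sym code≡half)))
      (inj₂ odd) →
        let s , s∈B , half≡ = mismatch-sound (half k) (left (half k)) (right (half k))
                                (trans (sym (nonMember-odd k odd)) eq)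
        in inj₂ (s , s∈B , trans (sym (parity+2*half k)) (cong₂ (λ p h → p + 2 * h) odd half≡))

    nonMember-domain : ∀ {s} → s ∈ B → nonMember (2 * code s) ≡ 0
    nonMember-domain {s} s∈B =
      trans (nonMember-even (2 * code s) (parity-even (code s))) (∈⇒absent≡0 (oracle o) (domain-code o s∈B))

    nonMember-graph : ∀ {s} → s ∈ B → nonMember (1 + 2 * pair (code s) (g (code s))) ≡ 0
    nonMember-graph {s} s∈B =
      trans (nonMember-odd (1 + 2 * m) (parity-odd m))
        (trans (cong notInGraph (half-odd m)) (notInGraph-complete s∈B))
      where m = pair (code s) (g (code s))

    codeOf : Subset
    codeOf = zeros nonMember

    codeOf-codes : codeOf Codes byCode g
    codeOf-codes k = mk⇔
      (λ k∈ → nonMember-sound k (≡ᵇ⇒≡ (nonMember k) 0 k∈))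
      (λ { (inj₁ (s , s∈B , eq)) → member (2 * code s) eq (nonMember-domain s∈B)
         ; (inj₂ (s , s∈B , eq)) → member (1 + 2 * pair (code s) (g (code s))) eq (nonMember-graph s∈B) })
      where
      member : ∀ n → k ≡ n → nonMember n ≡ 0 → k ∈ ⟪ codeOf ⟫
      member n eq n∈ = ≡⇒≡ᵇ (nonMember k) 0 (trans (cong nonMember eq) n∈)

  -- Computability of the new colouring and its code

  module _ {g : CodedColoring → ℕ → ℕ} (g-computable : Computable₁ g) where

    notInGraph-computable : Computable₁ (λ o → notInGraph o (g o))
    notInGraph-computable = function₁
      (+-computable $₂ (dist-computable $₂ var 0F , (pair-computable $₂ l , r))
                     , (+-computable $₂ (absent-computable $₁ (double-computable $₁ l))
                                      , (dist-computable $₂ (g-computable $₁ l) , r)))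
      where
      l : Computable (λ _ xs → left (lookup xs 0F))
      l = left-computable $₁ var 0F
      r : Computable (λ _ xs → right (lookup xs 0F))
      r = right-computable $₁ var 0F

    nonMember-computable : Computable₁ (λ o → nonMember o (g o))
    nonMember-computable = function₁
      (+-computable $₂ (*-computable $₂ (parity-computable $₁ var 0F)
                                      , (notInGraph-computable $₁ (half-computable $₁ var 0F)))
                     , (*-computable $₂ (not-computable $₁ (parity-computable $₁ var 0F))
                                      , (absent-computable $₁ var 0F)))

    codeOf-computable : Computable₁ (λ o → χ (codeOf o (g o)))
    codeOf-computable = ext₁ (λ o k → sym (χ-zeros (nonMember o (g o)) k))
      (function₁ (not-computable $₁ (nonMember-computable $₁ var 0F)))

  colored-computable : ∀ {n} {c d x : CodedColoring → Vec ℕ n → ℕ} →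
    Computable c → Computable d → Computable x →
    Computable (λ o xs → colored o (c o xs) (d o xs) (x o xs))
  colored-computable c d x =
    *-computable $₂ (χ-computable $₁ (double-computable $₁ c))
                  , (absent-computable $₁ (suc-computable $₁ (double-computable $₁ (pair-computable $₂ d , x))))

  -- In the predicates passed to `minimise`, variable 0 is the number sought and variable 1 is the
  -- argument.
  color-computable : Computable₁ color
  color-computable = minimise color-exists
    (function₂ (colored-computable (var 1F) (var 1F) (var 0F)))

  partner-computable : Computable₁ partner
  partner-computable = minimise partner-exists
    (function₂ (colored-computable (var 1F) (var 0F) (color-computable $₁ var 1F)))

  avoid-computable : Computable₁ avoid
  avoid-computable = minimise (λ o c → separator-exists c (partner o c)) (function₂
    (*-computable $₂ (∸-computable $₂ d , var 0F)
                   , (not-computable $₁ (*-computable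
                       $₂ (bit-computable $₂ var 0F , d)
                        , (not-computable $₁ (bit-computable $₂ var 0F , var 1F))))))
    where
    d : Computable (λ o xs → partner o (lookup xs 1F))
    d = partner-computable $₁ var 1F

  -- From solutions of the new colouring to solutions of the old

  module _ {X} (barrier : B IsBarrierOn X) (o : CodedColoring) (bounded : Bounded 2 (coloring o))
           {Y} (solution : Problem.IsSolutionTo (FS B) Y (byCode (avoid o))) where

    no-collision : ∀ {s t} (s∈B∣Y : s ∈ (B ∣ Y)) (t∈B∣Y : t ∈ (B ∣ Y)) →
      coloring o t (proj₁ t∈B∣Y) ≡ coloring o s (proj₁ s∈B∣Y) → code t ≮ code s
    no-collision {s} {t} s∈B∣Y@(s∈B , _) (t∈B , t⊆Y) ft≡fs t<s = avoid∉s (avoids (t⊆Y avoid∈t))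
      where
      avoids : avoid o (code s) ∈ ⟪ Y ⟫ → avoid o (code s) ∈ ⟦ s ⟧
      avoids = proj₂ (proj₂ solution) s s∈B∣Y

      separated : avoid o (code s) ∈ˡ elements t × avoid o (code s) ∉ˡ elements s
      -- The partner of s is t, and the antichain condition provides an element of t outside s for
      -- the search to find.
      separated = subst (λ d → separator (code s) d ∈ˡ elements t × separator (code s) d ∉ˡ elements s)
        (sym (partner-unique o bounded s∈B t∈B ft≡fs t<s))
        (separator-code s t (antichain-witness barrier t∈B s∈B (<⇒≢ t<s ∘ cong code)))

      avoid∈t = proj₁ separated
      avoid∉s = proj₂ separated

    injective : ∀ s t (s∈B∣Y : s ∈ (B ∣ Y)) (t∈B∣Y : t ∈ (B ∣ Y)) →
      coloring o s (proj₁ s∈B∣Y) ≡ coloring o t (proj₁ t∈B∣Y) → s ≡ t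
    injective s t s∈B∣Y t∈B∣Y fs≡ft with <-cmp (code s) (code t)
    -- The set with the larger code is the one whose new colour is examined.
    ... | tri< s<t _ _ = contradiction s<t (no-collision t∈B∣Y s∈B∣Y fs≡ft)
    ... | tri≈ _ s≡t _ = code-injective s≡t
    ... | tri> _ _ t<s = contradiction t<s (no-collision s∈B∣Y t∈B∣Y (sym fs≡ft))

    solves : Problem.IsSolutionTo (RRT₂ B) Y (coloring o , bounded)
    solves = proj₁ solution , proj₁ (proj₂ solution) , injective

  reduction : Computable₁ (λ o → χ (codeOf o (avoid o)))
  reduction = codeOf-computable avoid-computable

proposition11 : (B : Pred FinSet 0ℓ) (X : Pred ℕ 0ℓ) → B IsBarrierOn X → RRT₂ B ≤sW FS B
proposition11 B X barrier = program , query , λ (f , bounded) I codes →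
  let o = f , I , codes in
  byCode (avoid o) , codeOf o (avoid o) , codeOf-codes o (avoid o) , computes o ,
  -- A solution is returned unchanged, so the second functional merely queries its oracle.
  λ Y solution → Y , (λ _ → query⇓) , solves barrier o bounded solution
  where
  open Reduction B
  open Uniform.Computable₁ reduction
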